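{- There is a positive constant $c_1$ such that the following holds. Let $n$ be a positive integer, let $\mathcal A\subseteq \mathcal P([n])$ be a counterexample to the union-closed conjecture, let $\mathcal B=\mathcal P([n])\setminus \mathcal A$, and let $m=|\mathcal B|$. Then \[ \|\mathcal I(m)\| > m\left(\frac n2-1+c_1\right). \]
   Context: $[n]=\{1,\dots,n\}$ and $\mathcal P([n])$ is its power set. A family $\mathcal A$ of sets is union-closed if $A\cup B\in\mathcal A$ whenever $A,B\in\mathcal A$. For a family $\mathcal A$ and an integer $i$, $\deg_{\mathcal A}(i)=|\{A\in\mathcal A: i\in A\}|$. A counterexample to the union-closed conjecture is a union-closed family $\mathcal A\neq\{\emptyset\}$ such that $\deg_{\mathcal A}(i)<|\mathcal A|/2$ for every positive integer $i$. For a finite family $\mathcal F$ of finite sets, $\|\mathcal F\|=\sum_{F\in\mathcal F}|F|$. The colex order on finite sets of positive integers is defined by $A<B$ iff $\max(A\triangle B)\in B$; $\mathcal I(m)$ denotes the family of the first $m$ sets in this order (e.g. $\mathcal I(9)=\{\emptyset,\{1\},\{2\},\{1,2\},\{3\},\{1,3\},\{2,3\},\{1,2,3\},\{4\}\}$). -}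

module Defs where

open import Data.Bool using (Bool; true; false)
open import Data.Nat using (ℕ; zero; suc; _+_; _*_; _<_)
open import Data.Fin using (Fin; _<_)
open import Data.Fin.Subset using (Subset; _∪_; ⊥; ∣_∣; _∈_; _∉_)
open import Data.Vec using (Vec; []; _∷_)
open import Data.List using (List; []; _∷_; length; filterᵇ; map)
open import Data.Nat.ListAction using (sum)
open import Data.List.Relation.Unary.Unique.Propositional using (Unique)
import Data.List.Membership.Propositional as L
open import Data.Product using (Σ; _×_)
open import Function.Bundles using (_⇔_)
open import Relation.Nullary using (¬_)
open import Relation.Binary.PropositionalEquality using (_≡_)

-- A subset of [n] = {1,…,n} is a 'Subset n' (= Vec Bool n); the element
-- (i : Fin n) encodes the positive integer toℕ i + 1.
-- A family of subsets of [n] is a duplicate-free list of such subsets.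

-- membership of an arbitrary natural number i in a subset X of [n]
-- (false for i = 0 and for i > n).
memℕ : {n : ℕ} → ℕ → Subset n → Bool
memℕ zero          _       = false
memℕ (suc i)       []      = false
memℕ (suc zero)    (b ∷ _) = b
memℕ (suc (suc i)) (_ ∷ X) = memℕ (suc i) X

deg : {n : ℕ} → List (Subset n) → ℕ → ℕ
deg 𝒜 i = length (filterᵇ (memℕ i) 𝒜)

UnionClosed : {n : ℕ} → List (Subset n) → Set
UnionClosed 𝒜 = ∀ X Y → X L.∈ 𝒜 → Y L.∈ 𝒜 → (X ∪ Y) L.∈ 𝒜

Counterexample : {n : ℕ} → List (Subset n) → Set
Counterexample {n} 𝒜 =
  UnionClosed 𝒜 × ¬ (𝒜 ≡ (⊥ ∷ [])) × (∀ (i : ℕ) → 0 Data.Nat.< i → 2 * deg 𝒜 i Data.Nat.< length 𝒜)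

norm : {n : ℕ} → List (Subset n) → ℕ
norm ℱ = sum (map ∣_∣ ℱ)

-- colex order: A <colex B iff max(A △ B) ∈ B, i.e. there is j with
-- j ∈ B, j ∉ A, and A, B agree on every k > j.
_<colex_ : {n : ℕ} → Subset n → Subset n → Set
_<colex_ {n} A B = Σ (Fin n) λ j → j ∈ B × j ∉ A × (∀ (k : Fin n) → j Data.Fin.< k → (k ∈ A ⇔ k ∈ B))

-- ℱ is (as a family) the initial segment of the colex order of length
-- |ℱ|, i.e. ℱ = 𝓘(|ℱ|): distinct sets, downward closed under colex.
IsColexInitial : {n : ℕ} → List (Subset n) → Set
IsColexInitial {n} ℱ = Unique ℱ × (∀ (A B : Subset n) → B L.∈ ℱ → A <colex B → A L.∈ ℱ)

{-# OPTIONS --safe #-}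
module Submission where

-- Let f be the indicator of ℬ, N = 2ⁿ, E the number of edges of the cube
-- leaving ℬ, and Δᵢ = Σ_{X ∋ i} f X − Σ_{X ∌ i} f X. Being a counterexample
-- makes every Δᵢ positive; put D = Σ Δᵢ. Since 𝒜 is union-closed, a set of ℬ
-- has at most one lower neighbour in 𝒜, whence E + D ≤ 2m. Edge isoperimetry
-- gives nm ≤ E + 2‖𝓘(m)‖, which suffices unless D ≤ m/5. In that case the
-- (unnormalised) Fourier weight of f on level one is at most D², so f is concentrated on
-- levels 0 and ≥ 2, and E ≤ 2m forces m ≥ (25/51) N. For families that large
-- the estimate on ‖𝓘(m)‖ holds outright.

open import Defs
open import Data.Nat using (ℕ; suc)
open import Data.Fin.Subset using (Subset)
open import Data.List using (List; length)
open import Data.List.Relation.Unary.Unique.Propositional using (Unique)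
import Data.List.Membership.Propositional as L
open import Data.Product using (Σ; _×_)
open import Function.Bundles using (_⇔_)
open import Relation.Nullary using (¬_)
open import Relation.Binary.PropositionalEquality using (_≡_)

-- With E ≤ 2m alone, isoperimetry gives exactly m(n/2 - 1) and nothing to spare. The whole gain is
-- D/2, and positivity of the Δᵢ by itself only makes D at least n, which may be tiny against m;
-- hence the dichotomy. If D > m/5, the gain exceeds m/10, and this is the origin of c₁ = 1/10. For
-- small D the lever is an average. With unnormalised coefficients F̂(S), one has N·m = Σ F̂(S)² and
-- N·E = 2 Σ |S| F̂(S)², so E ≤ 2m says that the mean level |S| is at most 1. If level one carries
-- almost nothing, roughly half of the mass must sit at S = ∅, where it equals m²; so m is at least
-- about N/2. For such m it is enough that ‖𝓘(m)‖ falls short of nm/2 by less than 3N/8, which is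
-- below 9m/10. Everything is done over ℤ with denominators cleared; rationals enter only at the
-- end.

-- Certificates for integer inequalities

module IntegerOrder where

  open import Data.Integer hiding (suc; _⊖_)
  open import Data.Integer.Properties
  import Data.Nat as ℕ
  import Data.Nat.Properties as ℕ
  open import Relation.Binary.PropositionalEquality using (sym; subst)

  -- The shape of every polynomial inequality below: `j - i` is written as a sum of products of
  -- quantities already known to be nonnegative, and the ring solver checks the identity.
  ≤-by : ∀ {i j k} → 0ℤ ≤ k → j - i ≡ k → i ≤ j
  ≤-by 0≤k eq = 0≤i-j⇒j≤i (subst (0ℤ ≤_) (sym eq) 0≤k)

  gap : ∀ {i j} → i ≤ j → 0ℤ ≤ j - i
  gap = i≤j⇒0≤j-i

  infixl 6 _⊞_
  _⊞_ : ∀ {i j} → 0ℤ ≤ i → 0ℤ ≤ j → 0ℤ ≤ i + j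
  _⊞_ = +-mono-≤

  infixl 7 _⊠_
  _⊠_ : ∀ {i j} → 0ℤ ≤ i → 0ℤ ≤ j → 0ℤ ≤ i * j
  _⊠_ {+ a} {+ b} _ _ = subst (0ℤ ≤_) (pos-* a b) (+≤+ ℕ.z≤n)

  0≤+ : ∀ {n} → 0ℤ ≤ + n
  0≤+ = +≤+ ℕ.z≤n

  i≤i*i : ∀ i → i ≤ i * i
  i≤i*i (+ ℕ.zero)  = ≤-refl
  i≤i*i (+ (suc n)) = subst (+ (suc n) ≤_) (pos-* (suc n) (suc n)) (+≤+ (ℕ.m≤m*n (suc n) (suc n)))
  i≤i*i -[1+ n ]    = -≤+

  0≤i*i : ∀ i → 0ℤ ≤ i * i
  0≤i*i (+ n)    = 0≤+ {n} ⊠ 0≤+ {n}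
  0≤i*i -[1+ n ] = 0≤+

-- Sums, energy and Poincaré inequalities on the cube

module CubeSums where

  open IntegerOrder
  open import Data.Bool using (Bool; true; false)
  open import Data.Integer hiding (suc; _⊖_)
  open import Data.Integer.Properties
  open import Data.Integer.Tactic.RingSolver using (solve-∀)
  open import Data.Nat using (zero)
  open import Data.Vec using ([]; _∷_)
  open import Relation.Binary.PropositionalEquality using (refl; sym; trans; cong; cong₂; module ≡-Reasoning)

  private
    variable
      n : ℕ

  lo hi : {A : Set} → (Subset (suc n) → A) → Subset n → A
  lo F X = F (false ∷ X)
  hi F X = F (true ∷ X)

  infixl 6 _⊕_ _⊖_
  _⊕_ _⊖_ : (F G : Subset n → ℤ) → Subset n → ℤ
  (F ⊕ G) X = F X + G X
  (F ⊖ G) X = F X - G X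

  sq : (Subset n → ℤ) → Subset n → ℤ
  sq F X = F X * F X

  ∑ : (Subset n → ℤ) → ℤ
  ∑ {zero}  F = F []
  ∑ {suc n} F = ∑ (lo F) + ∑ (hi F)

  ∑-cong : {F G : Subset n → ℤ} → (∀ X → F X ≡ G X) → ∑ F ≡ ∑ G
  ∑-cong {zero}  eq = eq []
  ∑-cong {suc n} eq = cong₂ _+_ (∑-cong (λ X → eq (false ∷ X))) (∑-cong (λ X → eq (true ∷ X)))

  ∑-mono : {F G : Subset n → ℤ} → (∀ X → F X ≤ G X) → ∑ F ≤ ∑ G
  ∑-mono {zero}  le = le []
  ∑-mono {suc n} le = +-mono-≤ (∑-mono (λ X → le (false ∷ X))) (∑-mono (λ X → le (true ∷ X)))

  ∑-⊕ : (F G : Subset n → ℤ) → ∑ (F ⊕ G) ≡ ∑ F + ∑ G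
  ∑-⊕ {zero}  F G = refl
  ∑-⊕ {suc n} F G = trans (cong₂ _+_ (∑-⊕ (lo F) (lo G)) (∑-⊕ (hi F) (hi G)))
                          (shuffle (∑ (lo F)) (∑ (lo G)) (∑ (hi F)) (∑ (hi G)))
    where
    shuffle : ∀ a b c d → a + b + (c + d) ≡ a + c + (b + d)
    shuffle = solve-∀

  ∑-* : (c : ℤ) (F : Subset n → ℤ) → ∑ (λ X → c * F X) ≡ c * ∑ F
  ∑-* {zero}  c F = refl
  ∑-* {suc n} c F = trans (cong₂ _+_ (∑-* c (lo F)) (∑-* c (hi F))) (sym (*-distribˡ-+ c (∑ (lo F)) (∑ (hi F))))

  ∑-⊖ : (F G : Subset n → ℤ) → ∑ (F ⊖ G) ≡ ∑ F - ∑ G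
  ∑-⊖ F G = begin
    ∑ (F ⊖ G)                        ≡⟨ ∑-cong (λ X → cong (_+_ (F X)) (sym (-1*i≡-i (G X)))) ⟩
    ∑ (F ⊕ (λ X → -1ℤ * G X))        ≡⟨ ∑-⊕ F _ ⟩
    ∑ F + ∑ (λ X → -1ℤ * G X)        ≡⟨ cong (_+_ (∑ F)) (trans (∑-* -1ℤ G) (-1*i≡-i (∑ G))) ⟩
    ∑ F - ∑ G                        ∎
    where open ≡-Reasoning

  0≤∑sq : (F : Subset n → ℤ) → 0ℤ ≤ ∑ (sq F)
  0≤∑sq {zero}  F = 0≤i*i (F [])
  0≤∑sq {suc n} F = 0≤∑sq (lo F) ⊞ 0≤∑sq (hi F)

  ∑sq-parallelogram : (F G : Subset n → ℤ) →
    ∑ (sq (F ⊕ G)) + ∑ (sq (F ⊖ G)) ≡ + 2 * (∑ (sq F) + ∑ (sq G))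
  ∑sq-parallelogram F G = begin
    ∑ (sq (F ⊕ G)) + ∑ (sq (F ⊖ G))    ≡⟨ ∑-⊕ (sq (F ⊕ G)) (sq (F ⊖ G)) ⟨
    ∑ (sq (F ⊕ G) ⊕ sq (F ⊖ G))        ≡⟨ ∑-cong (λ X → identity (F X) (G X)) ⟩
    ∑ (λ X → + 2 * (sq F ⊕ sq G) X)    ≡⟨ ∑-* (+ 2) (sq F ⊕ sq G) ⟩
    + 2 * ∑ (sq F ⊕ sq G)              ≡⟨ cong (_*_ (+ 2)) (∑-⊕ (sq F) (sq G)) ⟩
    + 2 * (∑ (sq F) + ∑ (sq G))        ∎
    where
    open ≡-Reasoning
    identity : ∀ x y → (x + y) * (x + y) + (x - y) * (x - y) ≡ + 2 * (x * x + y * y)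
    identity = solve-∀

  -- Σ (F X − F Y)² over the edges XY of the cube.
  energy : (Subset n → ℤ) → ℤ
  energy {zero}  F = 0ℤ
  energy {suc n} F = energy (lo F) + energy (hi F) + ∑ (sq (lo F ⊖ hi F))

  0≤energy : (F : Subset n → ℤ) → 0ℤ ≤ energy F
  0≤energy {zero}  F = 0≤+
  0≤energy {suc n} F = 0≤energy (lo F) ⊞ 0≤energy (hi F) ⊞ 0≤∑sq (lo F ⊖ hi F)

  -- Together with `∑sq-parallelogram`, this passes from the pair of halves to their sum and
  -- difference, which is the Fourier transform in one coordinate up to a factor 2.
  energy-parallelogram : (F G : Subset n → ℤ) →
    energy (F ⊕ G) + energy (F ⊖ G) ≡ + 2 * (energy F + energy G)
  energy-parallelogram {zero}  F G = refl
  energy-parallelogram {suc n} F G =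
    combine (energy (lo F)) (energy (lo G)) (energy (hi F)) (energy (hi G))
      (∑ (sq (lo F ⊖ hi F))) (∑ (sq (lo G ⊖ hi G)))
      {energy (lo F ⊕ lo G)} {energy (lo F ⊖ lo G)} {energy (hi F ⊕ hi G)} {energy (hi F ⊖ hi G)}
      {∑ (sq (lo (F ⊕ G) ⊖ hi (F ⊕ G)))} {∑ (sq (lo (F ⊖ G) ⊖ hi (F ⊖ G)))}
      (energy-parallelogram (lo F) (lo G)) (energy-parallelogram (hi F) (hi G)) (begin
      ∑ (sq (lo (F ⊕ G) ⊖ hi (F ⊕ G))) + ∑ (sq (lo (F ⊖ G) ⊖ hi (F ⊖ G)))
        ≡⟨ cong₂ _+_
             (∑-cong (λ X → swap⁺ (lo F X) (lo G X) (hi F X) (hi G X)))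
             (∑-cong (λ X → swap⁻ (lo F X) (lo G X) (hi F X) (hi G X))) ⟩
      ∑ (sq ((lo F ⊖ hi F) ⊕ (lo G ⊖ hi G))) + ∑ (sq ((lo F ⊖ hi F) ⊖ (lo G ⊖ hi G)))
        ≡⟨ ∑sq-parallelogram (lo F ⊖ hi F) (lo G ⊖ hi G) ⟩
      + 2 * (∑ (sq (lo F ⊖ hi F)) + ∑ (sq (lo G ⊖ hi G))) ∎)
    where
    open ≡-Reasoning
    swap⁺ : ∀ a b c d → (a + b - (c + d)) * (a + b - (c + d)) ≡ (a - c + (b - d)) * (a - c + (b - d))
    swap⁺ = solve-∀
    swap⁻ : ∀ a b c d → (a - b - (c - d)) * (a - b - (c - d)) ≡ (a - c - (b - d)) * (a - c - (b - d))
    swap⁻ = solve-∀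
    combine : ∀ c d g h k l {a b e f i j} →
      a + b ≡ + 2 * (c + d) → e + f ≡ + 2 * (g + h) → i + j ≡ + 2 * (k + l) →
      a + e + i + (b + f + j) ≡ + 2 * (c + g + k + (d + h + l))
    combine c d g h k l {a} {b} {e} {f} {i} {j} p q r = begin
      a + e + i + (b + f + j)                           ≡⟨ regroup a b e f i j ⟩
      a + b + (e + f) + (i + j)                         ≡⟨ cong₂ _+_ (cong₂ _+_ p q) r ⟩
      + 2 * (c + d) + + 2 * (g + h) + + 2 * (k + l)     ≡⟨ regroup₂ c d g h k l ⟩
      + 2 * (c + g + k + (d + h + l))                   ∎
      where
      regroup : ∀ a b e f i j → a + e + i + (b + f + j) ≡ a + b + (e + f) + (i + j)
      regroup = solve-∀
      regroup₂ : ∀ c d g h k l → + 2 * (c + d) + + 2 * (g + h) + + 2 * (k + l) ≡ + 2 * (c + g + k + (d + h + l))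
      regroup₂ = solve-∀

  cubeSize : ℕ → ℤ
  cubeSize zero    = + 1
  cubeSize (suc n) = + 2 * cubeSize n

  0≤cubeSize : ∀ n → 0ℤ ≤ cubeSize n
  0≤cubeSize zero    = 0≤+
  0≤cubeSize (suc n) = 0≤+ {2} ⊠ 0≤cubeSize n

  -- level₁ F = Σᵢ (Σ_{X ∋ i} F X − Σ_{X ∌ i} F X)², up to scaling the
  -- Fourier weight of F on the first level; bias F is the sum of the
  -- same differences without squaring.
  level₁ bias : (Subset n → ℤ) → ℤ
  level₁ {zero}  F = 0ℤ
  level₁ {suc n} F = (∑ (hi F) - ∑ (lo F)) * (∑ (hi F) - ∑ (lo F)) + level₁ (lo F ⊕ hi F)
  bias {zero}  F = 0ℤ
  bias {suc n} F = ∑ (hi F) - ∑ (lo F) + bias (lo F ⊕ hi F)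

  -- Induction by a Fourier transform in one coordinate: `lo F ⊕ hi F` carries the characters
  -- avoiding the first coordinate, `lo F ⊖ hi F` those containing it. The latter gain one level
  -- from that coordinate, so `0≤energy` settles them here, and this very inequality settles them in
  -- `poincaré₂`.
  poincaré : (F : Subset n → ℤ) →
    + 2 * cubeSize n * ∑ (sq F) ≤ cubeSize n * energy F + + 2 * (∑ F * ∑ F)
  poincaré {zero} F = ≤-by {k = 0ℤ} ≤-refl (identity (F []))
    where
    identity : ∀ x → + 1 * + 0 + + 2 * (x * x) - + 2 * + 1 * (x * x) ≡ 0ℤ
    identity = solve-∀
  poincaré {suc n} F =
    ≤-by (gap (poincaré (lo F ⊕ hi F)) ⊞ 0≤cubeSize n ⊠ 0≤energy (lo F ⊖ hi F))
      (combine (cubeSize n) (∑ (lo F)) (∑ (hi F)) (energy (lo F)) (energy (hi F)) (∑ (sq (lo F))) (∑ (sq (hi F)))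
        (∑-⊕ (lo F) (hi F)) (energy-parallelogram (lo F) (hi F)) (∑sq-parallelogram (lo F) (hi F)))
    where
    open ≡-Reasoning
    combine : ∀ M a b e f ff gg {s ep eq pp qq} →
      s ≡ a + b → ep + eq ≡ + 2 * (e + f) → pp + qq ≡ + 2 * (ff + gg) →
      + 2 * M * (e + f + qq) + + 2 * ((a + b) * (a + b)) - + 2 * (+ 2 * M) * (ff + gg)
        ≡ M * ep + + 2 * (s * s) - + 2 * M * pp + M * eq
    combine M a b e f ff gg {s} {ep} {eq} {pp} {qq} refl p q = begin
      + 2 * M * (e + f + qq) + + 2 * ((a + b) * (a + b)) - + 2 * (+ 2 * M) * (ff + gg)
        ≡⟨ before M a b e f qq ff gg ⟩
      M * (+ 2 * (e + f)) + + 2 * M * qq + + 2 * ((a + b) * (a + b)) - + 2 * M * (+ 2 * (ff + gg))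
        ≡⟨ cong₂ (λ x y → M * x + + 2 * M * qq + + 2 * ((a + b) * (a + b)) - + 2 * M * y) p q ⟨
      M * (ep + eq) + + 2 * M * qq + + 2 * ((a + b) * (a + b)) - + 2 * M * (pp + qq)
        ≡⟨ after M a b ep eq pp qq ⟩
      M * ep + + 2 * ((a + b) * (a + b)) - + 2 * M * pp + M * eq ∎
      where
      before : ∀ M a b e f qq ff gg →
        + 2 * M * (e + f + qq) + + 2 * ((a + b) * (a + b)) - + 2 * (+ 2 * M) * (ff + gg) ≡
        M * (+ 2 * (e + f)) + + 2 * M * qq + + 2 * ((a + b) * (a + b)) - + 2 * M * (+ 2 * (ff + gg))
      before = solve-∀
      after : ∀ M a b ep eq pp qq →
        M * (ep + eq) + + 2 * M * qq + + 2 * ((a + b) * (a + b)) - + 2 * M * (pp + qq) ≡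
        M * ep + + 2 * ((a + b) * (a + b)) - + 2 * M * pp + M * eq
      after = solve-∀

  -- In Fourier terms: Σ |S| F̂(S)² ≥ 2 Σ F̂(S)² − 2 F̂(∅)² − Σᵢ F̂({i})².
  poincaré₂ : (F : Subset n → ℤ) →
    + 4 * cubeSize n * ∑ (sq F) ≤ cubeSize n * energy F + + 4 * (∑ F * ∑ F) + + 2 * level₁ F
  poincaré₂ {zero} F = ≤-by {k = 0ℤ} ≤-refl (identity (F []))
    where
    identity : ∀ x → + 1 * + 0 + + 4 * (x * x) + + 2 * + 0 - + 4 * + 1 * (x * x) ≡ 0ℤ
    identity = solve-∀
  poincaré₂ {suc n} F =
    ≤-by (gap (poincaré₂ (lo F ⊕ hi F)) ⊞ gap (poincaré (lo F ⊖ hi F)))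
      (combine (cubeSize n) (level₁ (lo F ⊕ hi F)) (∑ (lo F)) (∑ (hi F)) (energy (lo F)) (energy (hi F)) (∑ (sq (lo F))) (∑ (sq (hi F)))
        (∑-⊕ (lo F) (hi F)) (∑-⊖ (lo F) (hi F))
        (energy-parallelogram (lo F) (hi F)) (∑sq-parallelogram (lo F) (hi F)))
    where
    open ≡-Reasoning
    combine : ∀ M l a b e f ff gg {s d ep eq pp qq} →
      s ≡ a + b → d ≡ a - b → ep + eq ≡ + 2 * (e + f) → pp + qq ≡ + 2 * (ff + gg) →
      + 2 * M * (e + f + qq) + + 4 * ((a + b) * (a + b)) + + 2 * ((b - a) * (b - a) + l)
          - + 4 * (+ 2 * M) * (ff + gg)
        ≡ M * ep + + 4 * (s * s) + + 2 * l - + 4 * M * pp + (M * eq + + 2 * (d * d) - + 2 * M * qq)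
    combine M l a b e f ff gg {s} {d} {ep} {eq} {pp} {qq} refl refl p q = begin
      + 2 * M * (e + f + qq) + + 4 * ((a + b) * (a + b)) + + 2 * ((b - a) * (b - a) + l) - + 4 * (+ 2 * M) * (ff + gg)
        ≡⟨ before M l a b e f qq ff gg ⟩
      M * (+ 2 * (e + f)) + + 2 * M * qq + rest - + 4 * M * (+ 2 * (ff + gg))
        ≡⟨ cong₂ (λ x y → M * x + + 2 * M * qq + rest - + 4 * M * y) p q ⟨
      M * (ep + eq) + + 2 * M * qq + rest - + 4 * M * (pp + qq)
        ≡⟨ after M l a b ep eq pp qq ⟩
      M * ep + + 4 * ((a + b) * (a + b)) + + 2 * l - + 4 * M * pp + (M * eq + + 2 * ((a - b) * (a - b)) - + 2 * M * qq) ∎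
      where
      rest = + 4 * ((a + b) * (a + b)) + + 2 * ((b - a) * (b - a) + l)
      before : ∀ M l a b e f qq ff gg →
        + 2 * M * (e + f + qq) + + 4 * ((a + b) * (a + b)) + + 2 * ((b - a) * (b - a) + l) - + 4 * (+ 2 * M) * (ff + gg) ≡
        M * (+ 2 * (e + f)) + + 2 * M * qq + (+ 4 * ((a + b) * (a + b)) + + 2 * ((b - a) * (b - a) + l)) - + 4 * M * (+ 2 * (ff + gg))
      before = solve-∀
      after : ∀ M l a b ep eq pp qq →
        M * (ep + eq) + + 2 * M * qq + (+ 4 * ((a + b) * (a + b)) + + 2 * ((b - a) * (b - a) + l)) - + 4 * M * (pp + qq) ≡
        M * ep + + 4 * ((a + b) * (a + b)) + + 2 * l - + 4 * M * pp + (M * eq + + 2 * ((a - b) * (a - b)) - + 2 * M * qq)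
      after = solve-∀

  -- `bias` recurses on the merged function `lo F ⊕ hi F`, `energy` on the two halves separately;
  -- additivity reconciles the two recursions in `energy+bias`.
  bias-⊕ : (F G : Subset n → ℤ) → bias (F ⊕ G) ≡ bias F + bias G
  bias-⊕ {zero}  F G = refl
  bias-⊕ {suc n} F G = begin
    ∑ (hi F ⊕ hi G) - ∑ (lo F ⊕ lo G) + bias ((lo F ⊕ lo G) ⊕ (hi F ⊕ hi G))
      ≡⟨ cong₂ _+_ (cong₂ _-_ (∑-⊕ (hi F) (hi G)) (∑-⊕ (lo F) (lo G)))
           (trans (bias-⊕ (lo F ⊕ lo G) (hi F ⊕ hi G)) (cong₂ _+_ (bias-⊕ (lo F) (lo G)) (bias-⊕ (hi F) (hi G)))) ⟩
    ∑ (hi F) + ∑ (hi G) - (∑ (lo F) + ∑ (lo G)) + (bias (lo F) + bias (lo G) + (bias (hi F) + bias (hi G)))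
      ≡⟨ shuffle (∑ (hi F)) (∑ (hi G)) (∑ (lo F)) (∑ (lo G)) (bias (lo F)) (bias (lo G)) (bias (hi F)) (bias (hi G)) ⟩
    ∑ (hi F) - ∑ (lo F) + (bias (lo F) + bias (hi F)) + (∑ (hi G) - ∑ (lo G) + (bias (lo G) + bias (hi G)))
      ≡⟨ cong₂ (λ x y → ∑ (hi F) - ∑ (lo F) + x + (∑ (hi G) - ∑ (lo G) + y))
           (bias-⊕ (lo F) (hi F)) (bias-⊕ (lo G) (hi G)) ⟨
    bias F + bias G ∎
    where
    open ≡-Reasoning
    shuffle : ∀ a b c d e f g h → a + b - (c + d) + (e + f + (g + h)) ≡ a - c + (e + g) + (b - d + (f + h))
    shuffle = solve-∀

-- The recursion for the colex norm and its superadditivity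

module ColexNorm where

  open CubeSums using (lo; hi)
  open import Data.Bool using (Bool; true; false; if_then_else_)
  open import Data.Empty using (⊥-elim)
  open import Data.Fin using (zero; suc)
  open import Data.Nat hiding (suc)
  open import Data.Nat.Properties
  open import Data.Nat.Tactic.RingSolver using (solve-∀)
  open import Data.Product using (_,_)
  open import Data.Sum using (_⊎_; inj₁; inj₂)
  open import Data.Vec using ([]; _∷_; here; there)
  open import Function.Bundles using (mk⇔; Equivalence)
  open import Relation.Binary.PropositionalEquality using (refl; sym; trans; cong; cong₂; subst; subst₂)

  private
    variable
      n : ℕ

  -- ‖𝓘(m)‖ for m ≤ 2ⁿ: the sets of 𝓘(m) avoiding the element 1 and those
  -- containing it form, after deletion of 1, initial segments of sizes
  -- ⌈m/2⌉ and ⌊m/2⌋.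
  colexNorm : ℕ → ℕ → ℕ
  colexNorm zero    m = 0
  colexNorm (suc n) m = colexNorm n ⌊ m /2⌋ + colexNorm n ⌈ m /2⌉ + ⌊ m /2⌋

  -- The last digit of a binary addition; `carry` is the case of two odd summands.
  data HalvesOfSum (a b : ℕ) : Set where
    noCarry : ⌊ a + b /2⌋ ≡ ⌊ a /2⌋ + ⌊ b /2⌋ → ⌈ a + b /2⌉ ≡ ⌈ a /2⌉ + ⌈ b /2⌉ → HalvesOfSum a b
    carry   : ⌊ a + b /2⌋ ≡ suc (⌊ a /2⌋ + ⌊ b /2⌋) → ⌈ a + b /2⌉ ≡ suc (⌊ a /2⌋ + ⌊ b /2⌋) →
              ⌈ a /2⌉ ≡ suc ⌊ a /2⌋ → ⌈ b /2⌉ ≡ suc ⌊ b /2⌋ → HalvesOfSum a b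

  halvesOfSum : ∀ a b → HalvesOfSum a b
  halvesOfSum (suc (suc a)) b with halvesOfSum a b
  ... | noCarry p q   = noCarry (cong suc p) (cong suc q)
  ... | carry p q r s = carry (cong suc p) (cong suc q) (cong suc r) s
  halvesOfSum zero b = noCarry refl refl
  halvesOfSum (suc zero) zero = noCarry refl refl
  halvesOfSum (suc zero) (suc zero) = carry refl refl refl refl
  halvesOfSum (suc zero) (suc (suc b)) with halvesOfSum 1 b
  ... | noCarry p q   = noCarry (cong suc p) (cong suc q)
  ... | carry p q r s = carry (cong suc p) (cong suc q) r (cong suc s)

  ⌈n/2⌉≤1+⌊n/2⌋ : ∀ m → ⌈ m /2⌉ ≤ suc ⌊ m /2⌋
  ⌈n/2⌉≤1+⌊n/2⌋ zero          = z≤n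
  ⌈n/2⌉≤1+⌊n/2⌋ (suc zero)    = s≤s z≤n
  ⌈n/2⌉≤1+⌊n/2⌋ (suc (suc m)) = s≤s (⌈n/2⌉≤1+⌊n/2⌋ m)

  -- The arithmetic core of edge isoperimetry: initial segments of sizes `a` and `b` in opposite
  -- facets, joined by at most min(a, b) edges, have no more inner edges than one initial segment of
  -- size `a + b`. A free `c` below both sizes replaces the minimum, because it can be halved along
  -- with `a` and `b`.
  colexNorm-superadditive : ∀ n a b c → c ≤ a → c ≤ b →
    colexNorm n a + colexNorm n b + c ≤ colexNorm (suc n) (a + b)
  colexNorm-superadditive zero a b c c≤a c≤b =
    subst (_≤ ⌊ a + b /2⌋) (sym (n≡⌊n+n/2⌋ c)) (⌊n/2⌋-mono (+-mono-≤ c≤a c≤b))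
  colexNorm-superadditive (suc n) a b c c≤a c≤b with halvesOfSum a b
  ... | noCarry p q = subst₂ (λ x y → lhs ≤ colexNorm (suc n) x + colexNorm (suc n) y + x) (sym p) (sym q) (begin
      h a₀ + h a₁ + a₀ + (h b₀ + h b₁ + b₀) + c
        ≡⟨ cong (h a₀ + h a₁ + a₀ + (h b₀ + h b₁ + b₀) +_) (⌊n/2⌋+⌈n/2⌉≡n c) ⟨
      h a₀ + h a₁ + a₀ + (h b₀ + h b₁ + b₀) + (⌊ c /2⌋ + ⌈ c /2⌉)
        ≡⟨ shuffle (h a₀) (h a₁) a₀ (h b₀) (h b₁) b₀ ⌊ c /2⌋ ⌈ c /2⌉ ⟩
      h a₀ + h b₀ + ⌊ c /2⌋ + (h a₁ + h b₁ + ⌈ c /2⌉) + (a₀ + b₀)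
        ≤⟨ +-monoˡ-≤ (a₀ + b₀) (+-mono-≤
             (colexNorm-superadditive n a₀ b₀ ⌊ c /2⌋ (⌊n/2⌋-mono c≤a) (⌊n/2⌋-mono c≤b))
             (colexNorm-superadditive n a₁ b₁ ⌈ c /2⌉ (⌈n/2⌉-mono c≤a) (⌈n/2⌉-mono c≤b))) ⟩
      colexNorm (suc n) (a₀ + b₀) + colexNorm (suc n) (a₁ + b₁) + (a₀ + b₀) ∎)
    where
    open ≤-Reasoning
    h = colexNorm n
    a₀ = ⌊ a /2⌋
    a₁ = ⌈ a /2⌉
    b₀ = ⌊ b /2⌋
    b₁ = ⌈ b /2⌉
    lhs = colexNorm (suc n) a + colexNorm (suc n) b + c
    shuffle : ∀ a b c d e f g h → a + b + c + (d + e + f) + (g + h) ≡ a + d + g + (b + e + h) + (c + f)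
    shuffle = solve-∀
  -- Both sizes are odd, so the halves of `a + b` coincide. Pairing each floor with the other's
  -- ceiling makes both recursive sums equal to that half. The odd unit that `c` may have is paid by
  -- the carry in `suc (a₀ + b₀)`.
  ... | carry p q r s = subst₂ (λ x y → lhs ≤ colexNorm (suc n) x + colexNorm (suc n) y + x) (sym p) (sym q) (begin
      h a₀ + h a₁ + a₀ + (h b₀ + h b₁ + b₀) + c
        ≤⟨ +-monoʳ-≤ (h a₀ + h a₁ + a₀ + (h b₀ + h b₁ + b₀)) c≤ ⟩
      h a₀ + h a₁ + a₀ + (h b₀ + h b₁ + b₀) + suc (c₀ + c₀)
        ≡⟨ shuffle (h a₀) (h a₁) a₀ (h b₀) (h b₁) b₀ c₀ ⟩
      h a₀ + h b₁ + c₀ + (h a₁ + h b₀ + c₀) + suc (a₀ + b₀)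
        ≤⟨ +-monoˡ-≤ (suc (a₀ + b₀)) (+-mono-≤
             (colexNorm-superadditive n a₀ b₁ c₀ (⌊n/2⌋-mono c≤a) (≤-trans (⌊n/2⌋-mono c≤b) (⌊n/2⌋≤⌈n/2⌉ b)))
             (colexNorm-superadditive n a₁ b₀ c₀ (≤-trans (⌊n/2⌋-mono c≤a) (⌊n/2⌋≤⌈n/2⌉ a)) (⌊n/2⌋-mono c≤b))) ⟩
      colexNorm (suc n) (a₀ + b₁) + colexNorm (suc n) (a₁ + b₀) + suc (a₀ + b₀)
        ≡⟨ cong₂ (λ x y → colexNorm (suc n) x + colexNorm (suc n) y + suc (a₀ + b₀))
             (trans (cong (a₀ +_) s) (+-suc a₀ b₀)) (cong (_+ b₀) r) ⟩
      colexNorm (suc n) (suc (a₀ + b₀)) + colexNorm (suc n) (suc (a₀ + b₀)) + suc (a₀ + b₀) ∎)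
    where
    open ≤-Reasoning
    h = colexNorm n
    a₀ = ⌊ a /2⌋
    a₁ = ⌈ a /2⌉
    b₀ = ⌊ b /2⌋
    b₁ = ⌈ b /2⌉
    c₀ = ⌊ c /2⌋
    lhs = colexNorm (suc n) a + colexNorm (suc n) b + c
    c≤ : c ≤ suc (c₀ + c₀)
    c≤ = subst₂ _≤_ (⌊n/2⌋+⌈n/2⌉≡n c) (+-suc c₀ c₀) (+-monoʳ-≤ c₀ (⌈n/2⌉≤1+⌊n/2⌋ c))
    shuffle : ∀ a b c d e f g →
      a + b + c + (d + e + f) + suc (g + g) ≡ a + e + g + (b + d + g) + suc (c + f)
    shuffle = solve-∀

  -- Base case of `colexNorm-bound`, with equality at 1, 2 and 3.
  m≤1+colexNorm₂ : ∀ m → m ≤ suc (colexNorm 2 m)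
  m≤1+colexNorm₂ 0 = z≤n
  m≤1+colexNorm₂ 1 = s≤s z≤n
  m≤1+colexNorm₂ 2 = s≤s (s≤s z≤n)
  m≤1+colexNorm₂ 3 = s≤s (s≤s (s≤s z≤n))
  -- Beyond 4 the recursion no longer measures families on two points, but adding 4 to `m` still
  -- adds exactly 4 to `colexNorm 2 m`.
  m≤1+colexNorm₂ (suc (suc (suc (suc m)))) = begin
    4 + m                         ≤⟨ +-monoʳ-≤ 4 (m≤1+colexNorm₂ m) ⟩
    5 + colexNorm 2 m             ≡⟨ shuffle (⌊ ⌊ m /2⌋ /2⌋) (⌊ ⌈ m /2⌉ /2⌋) ⌊ m /2⌋ ⟩
    suc (colexNorm 2 (4 + m))     ∎
    where
    open ≤-Reasoning
    shuffle : ∀ x y z → 5 + (x + y + z) ≡ suc (suc x + suc y + suc (suc z))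
    shuffle = solve-∀

  -- Families as Boolean functions; the norm of an initial segment

  bit : Bool → ℕ
  bit b = if b then 1 else 0

  size weight : (Subset n → Bool) → ℕ
  size {zero}  f = bit (f [])
  size {suc n} f = size (lo f) + size (hi f)
  weight {zero}  f = 0
  weight {suc n} f = weight (lo f) + weight (hi f) + size (hi f)

  size-cong : {f g : Subset n → Bool} → (∀ X → f X ≡ g X) → size f ≡ size g
  size-cong {zero}  eq = cong bit (eq [])
  size-cong {suc n} eq = cong₂ _+_ (size-cong (λ X → eq (false ∷ X))) (size-cong (λ X → eq (true ∷ X)))

  size-mono : {f g : Subset n → Bool} → (∀ X → f X ≡ true → g X ≡ true) → size f ≤ size g
  size-mono {zero} {f} {g} imp with f [] in eq
  ... | false = z≤n
  ... | true rewrite imp [] eq = ≤-refl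
  size-mono {suc n} imp = +-mono-≤ (size-mono (λ X → imp (false ∷ X))) (size-mono (λ X → imp (true ∷ X)))

  InDifference : (f g : Subset n → Bool) → Subset n → Set
  InDifference f g X = f X ≡ true × g X ≡ false

  ⊆? : (f g : Subset n → Bool) → (∀ X → f X ≡ true → g X ≡ true) ⊎ Σ (Subset n) (InDifference f g)
  ⊆? {zero} f g with f [] in p | g [] in q
  ... | false | _     = inj₁ λ { [] eq → ⊥-elim (false≢true (trans (sym p) eq)) }
    where
    false≢true : ¬ false ≡ true
    false≢true ()
  ... | true  | true  = inj₁ λ { [] _ → q }
  ... | true  | false = inj₂ ([] , p , q)
  ⊆? {suc n} f g with ⊆? (lo f) (lo g) | ⊆? (hi f) (hi g)
  ... | inj₂ (X , d) | _            = inj₂ (false ∷ X , d)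
  ... | inj₁ _       | inj₂ (X , d) = inj₂ (true ∷ X , d)
  ... | inj₁ p       | inj₁ q       = inj₁ λ { (false ∷ X) → p X ; (true ∷ X) → q X }

  -- At most one half of the cube can meet the difference, so the unit is lost in only one of the
  -- two recursive bounds.
  size≤1+size : {f g : Subset n → Bool} →
    (∀ X Y → InDifference f g X → InDifference f g Y → X ≡ Y) → size f ≤ suc (size g)
  size≤1+size {zero} {f} {g} unique with f []
  ... | false = z≤n
  ... | true  = s≤s z≤n
  size≤1+size {suc n} {f} {g} unique with ⊆? (lo f) (lo g) | ⊆? (hi f) (hi g)
  ... | inj₁ p | _ = ≤-trans
    (+-mono-≤ (size-mono p) (size≤1+size (λ X Y d e → tail≡ (unique (true ∷ X) (true ∷ Y) d e))))
    (≤-reflexive (+-suc (size (lo g)) (size (hi g))))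
    where
    tail≡ : ∀ {X Y : Subset n} → true ∷ X ≡ true ∷ Y → X ≡ Y
    tail≡ refl = refl
  ... | inj₂ _ | inj₁ q =
    +-mono-≤ (size≤1+size (λ X Y d e → tail≡ (unique (false ∷ X) (false ∷ Y) d e))) (size-mono q)
    where
    tail≡ : ∀ {X Y : Subset n} → false ∷ X ≡ false ∷ Y → X ≡ Y
    tail≡ refl = refl
  ... | inj₂ (X , d) | inj₂ (Y , e) with unique (false ∷ X) (true ∷ Y) d e
  ... | ()

  -- The head of the vector is the smallest element, so colex lets the tails decide first.
  shift-colex : ∀ b c {X Y : Subset n} → X <colex Y → (b ∷ X) <colex (c ∷ Y)
  shift-colex b c (j , j∈Y , j∉X , agree) =
    suc j , there j∈Y , (λ { (there p) → j∉X p }) ,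
    λ { (suc k) (s≤s j<k) → mk⇔ (λ { (there p) → there (Equivalence.to (agree k j<k) p) })
                                (λ { (there p) → there (Equivalence.from (agree k j<k) p) }) }

  head-colex : (X : Subset n) → (false ∷ X) <colex (true ∷ X)
  head-colex X = zero , here , (λ ()) ,
    λ { (suc k) _ → mk⇔ (λ { (there p) → there p }) (λ { (there p) → there p }) }

  colex-connex : (X Y : Subset n) → X ≡ Y ⊎ X <colex Y ⊎ Y <colex X
  colex-connex [] [] = inj₁ refl
  colex-connex (x ∷ X) (y ∷ Y) with colex-connex X Y
  ... | inj₂ (inj₁ X<Y) = inj₂ (inj₁ (shift-colex x y X<Y))
  ... | inj₂ (inj₂ Y<X) = inj₂ (inj₂ (shift-colex y x Y<X))
  colex-connex (false ∷ X) (false ∷ .X) | inj₁ refl = inj₁ refl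
  colex-connex (false ∷ X) (true  ∷ .X) | inj₁ refl = inj₂ (inj₁ (head-colex X))
  colex-connex (true  ∷ X) (false ∷ .X) | inj₁ refl = inj₂ (inj₂ (head-colex X))
  colex-connex (true  ∷ X) (true  ∷ .X) | inj₁ refl = inj₁ refl

  Initial : (Subset n → Bool) → Set
  Initial f = ∀ X Y → f Y ≡ true → X <colex Y → f X ≡ true

  near-halves : ∀ a b → b ≤ a → a ≤ suc b → ⌊ a + b /2⌋ ≡ b × ⌈ a + b /2⌉ ≡ a
  near-halves a b b≤a a≤1+b with m≤n⇒m<n∨m≡n b≤a
  ... | inj₂ refl = sym (n≡⌊n+n/2⌋ b) , sym (n≡⌈n+n/2⌉ b)
  ... | inj₁ b<a with ≤-antisym a≤1+b b<a
  ... | refl = sym (n≡⌈n+n/2⌉ b) , cong suc (sym (n≡⌊n+n/2⌋ b))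

  weight-initial : (f : Subset n → Bool) → Initial f → weight f ≡ colexNorm n (size f)
  weight-initial {zero}  f init = refl
  weight-initial {suc n} f init
    with near-halves (size (lo f)) (size (hi f)) hi≤lo lo≤1+hi
    where
    hi≤lo : size (hi f) ≤ size (lo f)
    hi≤lo = size-mono (λ X X∈ → init (false ∷ X) (true ∷ X) X∈ (head-colex X))
    true≢false : ∀ {b} → b ≡ true → ¬ b ≡ false
    true≢false refl ()
    -- If `X <colex Y`, then `true ∷ X` precedes `false ∷ Y`. So only the colex-last set of `lo f`
    -- can be missing from `hi f`.
    lo≤1+hi : size (lo f) ≤ suc (size (hi f))
    lo≤1+hi = size≤1+size unique
      where
      unique : ∀ X Y → InDifference (lo f) (hi f) X → InDifference (lo f) (hi f) Y → X ≡ Y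
      unique X Y (X∈ , X∉) (Y∈ , Y∉) with colex-connex X Y
      ... | inj₁ X≡Y        = X≡Y
      ... | inj₂ (inj₁ X<Y) = ⊥-elim (true≢false (init (true ∷ X) (false ∷ Y) Y∈ (shift-colex true false X<Y)) X∉)
      ... | inj₂ (inj₂ Y<X) = ⊥-elim (true≢false (init (true ∷ Y) (false ∷ X) X∈ (shift-colex true false Y<X)) Y∉)
  ... | p , q rewrite p | q
    | weight-initial (lo f) (λ X Y Y∈ X<Y → init (false ∷ X) (false ∷ Y) Y∈ (shift-colex false false X<Y))
    | weight-initial (hi f) (λ X Y Y∈ X<Y → init (true ∷ X) (true ∷ Y) Y∈ (shift-colex true true X<Y)) =
      cong (_+ size (hi f)) (+-comm (colexNorm n (size (lo f))) (colexNorm n (size (hi f))))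

-- Edge isoperimetry and a lower bound for the colex norm

module Indicators where

  open IntegerOrder
  open CubeSums
  open ColexNorm
  open import Data.Bool using (Bool; true; false; not; if_then_else_)
  open import Data.Fin using (Fin; zero; suc; toℕ)
  open import Data.Fin.Subset using (∣_∣; _∪_)
  open import Data.Integer hiding (suc; _⊖_; ∣_∣)
  open import Data.Integer.Properties
  open import Data.Integer.Tactic.RingSolver using (solve-∀)
  open import Data.Nat using (zero; z≤n; ⌊_/2⌋; ⌈_/2⌉)
  import Data.Nat as ℕ
  import Data.Nat.Properties as ℕ
  open import Data.Sum using (_⊎_; inj₁; inj₂)
  open import Data.Vec using ([]; _∷_)
  open import Relation.Binary.PropositionalEquality using (refl; sym; trans; cong; cong₂; subst; module ≡-Reasoning)

  private
    variable
      n : ℕ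

  ind : (Subset n → Bool) → Subset n → ℤ
  ind f X = + bit (f X)

  ∑-ind : (f : Subset n → Bool) → ∑ (ind f) ≡ + size f
  ∑-ind {zero}  f = refl
  ∑-ind {suc n} f = cong₂ _+_ (∑-ind (lo f)) (∑-ind (hi f))

  ∑-sq-ind : (f : Subset n → Bool) → ∑ (sq (ind f)) ≡ + size f
  ∑-sq-ind f = trans (∑-cong (λ X → idempotent (f X))) (∑-ind f)
    where
    idempotent : ∀ b → + bit b * + bit b ≡ + bit b
    idempotent false = refl
    idempotent true  = refl

  ∑-ind-card : (f : Subset n → Bool) → ∑ (λ X → ind f X * + ∣ X ∣) ≡ + weight f
  ∑-ind-card {zero}  f = *-zeroʳ (+ bit (f []))
  ∑-ind-card {suc n} f = begin
    ∑ (λ X → ind (lo f) X * + ∣ X ∣) + ∑ (λ X → ind (hi f) X * + suc ∣ X ∣)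
      ≡⟨ cong₂ _+_ (∑-ind-card (lo f)) (trans (∑-cong (λ X → step (ind (hi f) X) (+ ∣ X ∣)))
           (trans (∑-⊕ (λ X → ind (hi f) X * + ∣ X ∣) (ind (hi f))) (cong₂ _+_ (∑-ind-card (hi f)) (∑-ind (hi f))))) ⟩
    + weight (lo f) + (+ weight (hi f) + + size (hi f))
      ≡⟨ +-assoc (+ weight (lo f)) (+ weight (hi f)) (+ size (hi f)) ⟨
    + weight f ∎
    where
    open ≡-Reasoning
    step : ∀ x y → x * (+ 1 + y) ≡ x * y + x
    step = solve-∀

  -- Integrality enters here, through t ≤ t². For indicators it says that the boundary edges in one
  -- direction number at least the difference of the two half-sizes.
  ∑sq⊖-ge : (F G : Subset n → ℤ) → ∑ F - ∑ G ≤ ∑ (sq (F ⊖ G))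
  ∑sq⊖-ge F G = subst (_≤ ∑ (sq (F ⊖ G))) (∑-⊖ F G) (∑-mono (λ X → i≤i*i (F X - G X)))

  ∑sq⊖-comm : (F G : Subset n → ℤ) → ∑ (sq (F ⊖ G)) ≡ ∑ (sq (G ⊖ F))
  ∑sq⊖-comm F G = ∑-cong (λ X → flip (F X) (G X))
    where
    flip : ∀ x y → (x - y) * (x - y) ≡ (y - x) * (y - x)
    flip = solve-∀

  -- Each set has n neighbours, so nm counts inner edges twice and boundary edges once. In a
  -- down-closed family such as 𝓘(m) the sum of cardinalities counts inner edges by their upper
  -- ends; the claim is thus that 𝓘(m) has the most inner edges.
  edge-isoperimetry : (f : Subset n → Bool) →
    + n * + size f ≤ energy (ind f) + + 2 * + colexNorm n (size f)
  edge-isoperimetry {zero}  f = ≤-refl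
  edge-isoperimetry {suc n} f = byOrder (ℕ.≤-total a b)
    where
    a = size (lo f)
    b = size (hi f)
    E₀ = energy (ind (lo f))
    E₁ = energy (ind (hi f))
    H = colexNorm n
    Q = ∑ (sq (ind (lo f) ⊖ ind (hi f)))
    superadditive : ∀ c → c ℕ.≤ a → c ℕ.≤ b → 0ℤ ≤ + colexNorm (suc n) (a ℕ.+ b) - (+ H a + + H b + + c)
    superadditive c c≤a c≤b = gap (+≤+ (colexNorm-superadditive n a b c c≤a c≤b))
    Q≥a-b : + a - + b ≤ Q
    Q≥a-b = subst (_≤ Q) (cong₂ _-_ (∑-ind (lo f)) (∑-ind (hi f))) (∑sq⊖-ge (ind (lo f)) (ind (hi f)))
    Q≥b-a : + b - + a ≤ Q
    Q≥b-a = subst (+ b - + a ≤_) (∑sq⊖-comm (ind (hi f)) (ind (lo f)))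
      (subst (_≤ ∑ (sq (ind (hi f) ⊖ ind (lo f)))) (cong₂ _-_ (∑-ind (hi f)) (∑-ind (lo f))) (∑sq⊖-ge (ind (hi f)) (ind (lo f))))
    -- One identity serves both orders of the half-sizes: `c` is their minimum and `d` their
    -- distance, a + b - 2c.
    identity : ∀ ν a b E₀ E₁ h₀ h₁ h q c d → d ≡ a + b - + 2 * c →
      E₀ + E₁ + q + + 2 * h - (+ 1 + ν) * (a + b) ≡
      E₀ + + 2 * h₀ - ν * a + (E₁ + + 2 * h₁ - ν * b) + (h - (h₀ + h₁ + c) + (h - (h₀ + h₁ + c))) + (q - d)
    identity ν a b E₀ E₁ h₀ h₁ h q c d refl = lemma ν a b E₀ E₁ h₀ h₁ h q c
      where
      lemma : ∀ ν a b E₀ E₁ h₀ h₁ h q c → E₀ + E₁ + q + + 2 * h - (+ 1 + ν) * (a + b) ≡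
        E₀ + + 2 * h₀ - ν * a + (E₁ + + 2 * h₁ - ν * b) + (h - (h₀ + h₁ + c) + (h - (h₀ + h₁ + c))) + (q - (a + b - + 2 * c))
      lemma = solve-∀
    b-a : ∀ a b → b - a ≡ a + b - + 2 * a
    b-a = solve-∀
    a-b : ∀ a b → a - b ≡ a + b - + 2 * b
    a-b = solve-∀
    byOrder : a ℕ.≤ b ⊎ b ℕ.≤ a →
      + suc n * + size f ≤ energy (ind f) + + 2 * + colexNorm (suc n) (size f)
    byOrder (inj₁ a≤b) =
      ≤-by (gap (edge-isoperimetry (lo f)) ⊞ gap (edge-isoperimetry (hi f))
             ⊞ (superadditive a ℕ.≤-refl a≤b ⊞ superadditive a ℕ.≤-refl a≤b) ⊞ gap Q≥b-a)
        (identity (+ n) (+ a) (+ b) E₀ E₁ (+ H a) (+ H b) (+ colexNorm (suc n) (a ℕ.+ b)) Q (+ a) (+ b - + a) (b-a (+ a) (+ b)))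
    byOrder (inj₂ b≤a) =
      ≤-by (gap (edge-isoperimetry (lo f)) ⊞ gap (edge-isoperimetry (hi f))
             ⊞ (superadditive b b≤a ℕ.≤-refl ⊞ superadditive b b≤a ℕ.≤-refl) ⊞ gap Q≥a-b)
        (identity (+ n) (+ a) (+ b) E₀ E₁ (+ H a) (+ H b) (+ colexNorm (suc n) (a ℕ.+ b)) Q (+ b) (+ a - + b) (a-b (+ a) (+ b)))

  -- The summand 4 absorbs parity: the two halves contribute 8, one 4 is kept, and the other pays
  -- for ⌈m/2⌉ - ⌊m/2⌋ ≤ 1. Starting in dimension 2 matters: dimension 0 or 1 would force
  -- coefficient 4 in place of 3, which is too weak for m near (25/51)·2ⁿ.
  colexNorm-bound : ∀ k m →
    + 4 * + (2 ℕ.+ k) * + m + + 4 ≤ + 3 * cubeSize (2 ℕ.+ k) + + 8 * + colexNorm (2 ℕ.+ k) m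
  colexNorm-bound zero m = ≤-by (0≤+ {8} ⊠ gap (+≤+ (m≤1+colexNorm₂ m))) (identity (+ m) (+ colexNorm 2 m))
    where
    identity : ∀ m h → + 3 * + 4 + + 8 * h - (+ 4 * + 2 * m + + 4) ≡ + 8 * (+ 1 + h - m)
    identity = solve-∀
  colexNorm-bound (suc k) m = subst (λ x → + 4 * + (3 ℕ.+ k) * + x + + 4 ≤ rhs) (ℕ.⌊n/2⌋+⌈n/2⌉≡n m)
    (≤-by (gap (colexNorm-bound k ⌊ m /2⌋) ⊞ gap (colexNorm-bound k ⌈ m /2⌉) ⊞ 0≤+ {4} ⊠ gap (+≤+ (⌈n/2⌉≤1+⌊n/2⌋ m)))
      (identity (+ (2 ℕ.+ k)) (cubeSize (2 ℕ.+ k)) (+ ⌊ m /2⌋) (+ ⌈ m /2⌉)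
        (+ colexNorm (2 ℕ.+ k) ⌊ m /2⌋) (+ colexNorm (2 ℕ.+ k) ⌈ m /2⌉)))
    where
    rhs = + 3 * cubeSize (3 ℕ.+ k) + + 8 * + colexNorm (3 ℕ.+ k) m
    identity : ∀ ν N a b h₀ h₁ → + 3 * (+ 2 * N) + + 8 * (h₀ + h₁ + a) - (+ 4 * (+ 1 + ν) * (a + b) + + 4) ≡
      + 3 * N + + 8 * h₀ - (+ 4 * ν * a + + 4) + (+ 3 * N + + 8 * h₁ - (+ 4 * ν * b + + 4)) + + 4 * (+ 1 + a - b)
    identity = solve-∀

  -- Coordinate biases of a family and of its complement

  sign± : Bool → ℤ
  sign± b = if b then + 1 else -1ℤ

  signAt : Fin n → Subset n → ℤ
  signAt i X = sign± (memℕ (suc (toℕ i)) X)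

  biasAt : Fin n → (Subset n → ℤ) → ℤ
  biasAt i F = ∑ (λ X → signAt i X * F X)

  biasAt-zero : (F : Subset (suc n) → ℤ) → biasAt zero F ≡ ∑ (hi F) - ∑ (lo F)
  biasAt-zero F = trans (cong₂ _+_ (∑-* -1ℤ (lo F)) (∑-* (+ 1) (hi F))) (identity (∑ (lo F)) (∑ (hi F)))
    where
    identity : ∀ x y → -1ℤ * x + + 1 * y ≡ y - x
    identity = solve-∀

  biasAt-suc : (i : Fin n) (F : Subset (suc n) → ℤ) → biasAt (suc i) F ≡ biasAt i (lo F ⊕ hi F)
  biasAt-suc i F = trans (sym (∑-⊕ (λ X → signAt i X * lo F X) (λ X → signAt i X * hi F X)))
    (∑-cong (λ X → sym (*-distribˡ-+ (signAt i X) (lo F X) (hi F X))))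

  0≤bias : (F : Subset n → ℤ) → (∀ i → 0ℤ < biasAt i F) → 0ℤ ≤ bias F
  0≤bias {zero}  F pos = ≤-refl
  0≤bias {suc n} F pos = subst (0ℤ ≤_) (biasAt-zero F) (<⇒≤ (pos zero))
    ⊞ 0≤bias (lo F ⊕ hi F) (λ i → subst (0ℤ <_) (biasAt-suc i F) (pos (suc i)))

  -- Strictness comes from the first coordinate, hence the dimension `suc n`. It later yields `0<m`,
  -- which allows cancelling `m`.
  0<bias : (F : Subset (suc n) → ℤ) → (∀ i → 0ℤ < biasAt i F) → 0ℤ < bias F
  0<bias F pos = +-mono-<-≤ (subst (0ℤ <_) (biasAt-zero F) (pos zero))
    (0≤bias (lo F ⊕ hi F) (λ i → subst (0ℤ <_) (biasAt-suc i F) (pos (suc i))))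

  -- A sum of squares against the square of a sum: with all coordinate biases positive, the cross
  -- terms are nonnegative.
  level₁≤bias² : (F : Subset n → ℤ) → (∀ i → 0ℤ < biasAt i F) → level₁ F ≤ bias F * bias F
  level₁≤bias² {zero}  F pos = ≤-refl
  level₁≤bias² {suc n} F pos =
    ≤-by (gap (level₁≤bias² (lo F ⊕ hi F) pos′) ⊞ (0≤d ⊠ 0≤D ⊞ 0≤d ⊠ 0≤D))
      (identity (∑ (hi F) - ∑ (lo F)) (bias (lo F ⊕ hi F)) (level₁ (lo F ⊕ hi F)))
    where
    pos′ : ∀ i → 0ℤ < biasAt i (lo F ⊕ hi F)
    pos′ i = subst (0ℤ <_) (biasAt-suc i F) (pos (suc i))
    0≤d : 0ℤ ≤ ∑ (hi F) - ∑ (lo F)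
    0≤d = subst (0ℤ ≤_) (biasAt-zero F) (<⇒≤ (pos zero))
    0≤D : 0ℤ ≤ bias (lo F ⊕ hi F)
    0≤D = 0≤bias (lo F ⊕ hi F) pos′
    identity : ∀ d D l → (d + D) * (d + D) - (d * d + l) ≡ D * D - l + (d * D + d * D)
    identity = solve-∀

  complement : (Subset n → Bool) → Subset n → Bool
  complement a X = not (a X)

  ∑-sign : (i : Fin n) → ∑ (signAt i) ≡ 0ℤ
  ∑-sign {suc n} zero    = trans (sym (∑-⊕ {n} (λ _ → -1ℤ) (λ _ → + 1))) (∑0 n)
    where
    ∑0 : ∀ n → ∑ {n} (λ _ → 0ℤ) ≡ 0ℤ
    ∑0 zero    = refl
    ∑0 (suc n) = cong₂ _+_ (∑0 n) (∑0 n)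
  ∑-sign {suc n} (suc i) = cong₂ _+_ (∑-sign i) (∑-sign i)

  -- The signs cancel over the whole cube, so complementing merely negates the bias; what results is
  -- |𝒜| - 2·deg, the quantity that a counterexample makes positive.
  biasAt-complement : (i : Fin n) (a : Subset n → Bool) →
    biasAt i (ind (complement a)) ≡ + size a - + 2 * ∑ (λ X → ind a X * + bit (memℕ (suc (toℕ i)) X))
  biasAt-complement {n} i a = begin
    biasAt i (ind (complement a))
      ≡⟨ ∑-cong (λ X → pointwise (a X) (memℕ (suc (toℕ i)) X)) ⟩
    ∑ (signAt i ⊕ (ind a ⊖ λ X → + 2 * degree X))
      ≡⟨ ∑-⊕ (signAt i) (ind a ⊖ λ X → + 2 * degree X) ⟩
    ∑ (signAt i) + ∑ (ind a ⊖ λ X → + 2 * degree X)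
      ≡⟨ cong₂ _+_ (∑-sign i) (∑-⊖ (ind a) (λ X → + 2 * degree X)) ⟩
    0ℤ + (∑ (ind a) - ∑ (λ X → + 2 * degree X))
      ≡⟨ +-identityˡ _ ⟩
    ∑ (ind a) - ∑ (λ X → + 2 * degree X)
      ≡⟨ cong₂ _-_ (∑-ind a) (∑-* (+ 2) degree) ⟩
    + size a - + 2 * ∑ degree ∎
    where
    open ≡-Reasoning
    degree : Subset n → ℤ
    degree X = ind a X * + bit (memℕ (suc (toℕ i)) X)
    pointwise : ∀ b c → sign± c * + bit (not b) ≡ sign± c + (+ bit b - + 2 * (+ bit b * + bit c))
    pointwise false false = refl
    pointwise false true  = refl
    pointwise true  false = refl
    pointwise true  true  = refl

  -- The number of i ∈ X with a (X ∖ {i}) ≡ true.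
  lowerNeighbours : (Subset n → Bool) → Subset n → ℕ
  lowerNeighbours a []          = 0
  lowerNeighbours a (false ∷ X) = lowerNeighbours (lo a) X
  lowerNeighbours a (true ∷ X)  = bit (lo a X) ℕ.+ lowerNeighbours (hi a) X

  -- In direction i, an edge leaving the complement of a downwards
  -- contributes +1 to the bias and one leaving it upwards contributes −1.
  energy+bias : (a : Subset n → Bool) →
    energy (ind (complement a)) + bias (ind (complement a)) ≡
    + 2 * ∑ (λ X → ind (complement a) X * + lowerNeighbours a X)
  energy+bias {zero}  a = cong (_*_ (+ 2)) (sym (*-zeroʳ (ind (complement a) [])))
  energy+bias {suc n} a = begin
    energy F₀ + energy F₁ + Q + (∑ F₁ - ∑ F₀ + bias (F₀ ⊕ F₁))
      ≡⟨ cong (λ x → energy F₀ + energy F₁ + Q + (∑ F₁ - ∑ F₀ + x)) (bias-⊕ F₀ F₁) ⟩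
    energy F₀ + energy F₁ + Q + (∑ F₁ - ∑ F₀ + (bias F₀ + bias F₁))
      ≡⟨ regroup (energy F₀) (energy F₁) Q (∑ F₁) (∑ F₀) (bias F₀) (bias F₁) ⟩
    energy F₀ + bias F₀ + (energy F₁ + bias F₁) + (Q + (∑ F₁ - ∑ F₀))
      ≡⟨ cong₂ _+_ (cong₂ _+_ (energy+bias (lo a)) (energy+bias (hi a))) lastEdges ⟩
    + 2 * ∑ U₀ + + 2 * ∑ U₁ + + 2 * ∑ V
      ≡⟨ factor (∑ U₀) (∑ U₁) (∑ V) ⟩
    + 2 * (∑ U₀ + (∑ V + ∑ U₁))
      ≡⟨ cong (λ x → + 2 * (∑ U₀ + x)) (trans (sym (∑-⊕ V U₁))
           (∑-cong (λ X → sym (*-distribˡ-+ (F₁ X) (+ bit (lo a X)) (+ lowerNeighbours (hi a) X))))) ⟩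
    + 2 * ∑ (λ X → ind (complement a) X * + lowerNeighbours a X) ∎
    where
    open ≡-Reasoning
    F₀ F₁ U₀ U₁ V : Subset n → ℤ
    F₀ = ind (complement (lo a))
    F₁ = ind (complement (hi a))
    U₀ X = F₀ X * + lowerNeighbours (lo a) X
    U₁ X = F₁ X * + lowerNeighbours (hi a) X
    V X = F₁ X * + bit (lo a X)
    Q = ∑ (sq (F₀ ⊖ F₁))
    regroup : ∀ a b c d e f g → a + b + c + (d - e + (f + g)) ≡ a + f + (b + g) + (c + (d - e))
    regroup = solve-∀
    factor : ∀ a b c → + 2 * a + + 2 * b + + 2 * c ≡ + 2 * (a + (c + b))
    factor = solve-∀
    pointwise : ∀ b c → (+ bit (not b) - + bit (not c)) * (+ bit (not b) - + bit (not c)) + (+ bit (not c) - + bit (not b))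
                      ≡ + 2 * (+ bit (not c) * + bit b)
    pointwise false false = refl
    pointwise false true  = refl
    pointwise true  false = refl
    pointwise true  true  = refl
    lastEdges : Q + (∑ F₁ - ∑ F₀) ≡ + 2 * ∑ V
    lastEdges = begin
      Q + (∑ F₁ - ∑ F₀)                    ≡⟨ cong (_+_ Q) (∑-⊖ F₁ F₀) ⟨
      Q + ∑ (F₁ ⊖ F₀)                      ≡⟨ ∑-⊕ (sq (F₀ ⊖ F₁)) (F₁ ⊖ F₀) ⟨
      ∑ (sq (F₀ ⊖ F₁) ⊕ (F₁ ⊖ F₀))         ≡⟨ ∑-cong (λ X → pointwise (lo a X) (hi a X)) ⟩
      ∑ (λ X → + 2 * V X)                  ≡⟨ ∑-* (+ 2) V ⟩
      + 2 * ∑ V                            ∎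

  -- The boundary of the complement of a union-closed family

  UnionClosedᵇ : (Subset n → Bool) → Set
  UnionClosedᵇ a = ∀ X Y → a X ≡ true → a Y ≡ true → a (X ∪ Y) ≡ true

  lowerNeighbours≡0 : (a : Subset n → Bool) (X : Subset n) →
    (∀ Y → X ∪ Y ≡ X → a Y ≡ false) → lowerNeighbours a X ≡ 0
  lowerNeighbours≡0 a []          none = refl
  lowerNeighbours≡0 a (false ∷ X) none =
    lowerNeighbours≡0 (lo a) X (λ Y eq → none (false ∷ Y) (cong (false ∷_) eq))
  lowerNeighbours≡0 a (true ∷ X)  none = cong₂ ℕ._+_
    (cong bit (none (false ∷ X) (cong (true ∷_) (∪-idem X))))
    (lowerNeighbours≡0 (hi a) X (λ Y eq → none (true ∷ Y) (cong (true ∷_) eq)))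
    where open import Data.Fin.Subset.Properties using (∪-idem)

  -- Two distinct lower neighbours of X have union X, which closure would put into the family.
  lowerNeighbours≤1 : (a : Subset n → Bool) → UnionClosedᵇ a → (X : Subset n) → a X ≡ false →
    lowerNeighbours a X ℕ.≤ 1
  lowerNeighbours≤1 a closed []          X∉ = z≤n
  lowerNeighbours≤1 a closed (false ∷ X) X∉ =
    lowerNeighbours≤1 (lo a) (λ Y Z → closed (false ∷ Y) (false ∷ Z)) X X∉
  lowerNeighbours≤1 a closed (true ∷ X)  X∉ with a (false ∷ X) in eq
  ... | false = lowerNeighbours≤1 (hi a) (λ Y Z → closed (true ∷ Y) (true ∷ Z)) X X∉
  -- One neighbour is found, and the rest must vanish. More is true: no `true ∷ Y` with Y inside X
  -- is a member, since its union with `false ∷ X` is `true ∷ X`. The inclusion is encoded as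
  -- `X ∪ Y ≡ X`.
  ... | true  = ℕ.≤-reflexive (cong suc (lowerNeighbours≡0 (hi a) X none))
    where
    none : ∀ Y → X ∪ Y ≡ X → a (true ∷ Y) ≡ false
    none Y X∪Y≡X with a (true ∷ Y) in eq′
    ... | false = refl
    ... | true  = trans (sym (closed (false ∷ X) (true ∷ Y) eq eq′)) (trans (cong (λ Z → a (true ∷ Z)) X∪Y≡X) X∉)

  energy+bias≤ : (a : Subset n → Bool) → UnionClosedᵇ a →
    energy (ind (complement a)) + bias (ind (complement a)) ≤ + 2 * + size (complement a)
  energy+bias≤ a closed = begin
    energy (ind (complement a)) + bias (ind (complement a))        ≡⟨ energy+bias a ⟩
    + 2 * ∑ (λ X → ind (complement a) X * + lowerNeighbours a X)   ≤⟨ *-monoˡ-≤-nonNeg (+ 2) (∑-mono pointwise) ⟩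
    + 2 * ∑ (ind (complement a))                                   ≡⟨ cong (_*_ (+ 2)) (∑-ind (complement a)) ⟩
    + 2 * + size (complement a)                                    ∎
    where
    open ≤-Reasoning
    pointwise : ∀ X → ind (complement a) X * + lowerNeighbours a X ≤ ind (complement a) X
    pointwise X with a X in eq
    ... | true  = ≤-refl
    ... | false = ≤-trans (≤-reflexive (*-identityˡ _)) (+≤+ (lowerNeighbours≤1 a closed X eq))

-- From duplicate-free lists to indicators; the integer inequality

module Families where

  open IntegerOrder
  open CubeSums
  open ColexNorm
  open Indicators
  open import Data.Bool using (Bool; true; false; not)
  import Data.Bool as Bool
  open import Data.Fin using (Fin; toℕ)
  open import Data.Fin.Subset using (∣_∣)
  open import Data.Integer hiding (suc; _⊖_; ∣_∣; _≟_)
  open import Data.Integer.Properties hiding (_≟_)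
  open import Data.Integer.Tactic.RingSolver using (solve-∀)
  open import Data.List using ([]; _∷_; map; filterᵇ)
  import Data.List.Relation.Unary.All as All
  open import Data.List.Relation.Unary.AllPairs using (_∷_)
  open import Data.Nat using (zero)
  import Data.Nat as ℕ
  import Data.Nat.Properties as ℕ
  open import Data.Nat.ListAction using (sum)
  open import Data.Product using (_,_)
  open import Data.Vec using ([]; _∷_)
  import Data.Vec.Properties as Vec
  open import Function.Bundles using (Equivalence)
  open import Relation.Binary.Definitions using (DecidableEquality)
  open import Relation.Binary.PropositionalEquality using (refl; sym; trans; cong; cong₂; subst; subst₂; module ≡-Reasoning)
  open import Relation.Nullary using (does; yes; no)
  open import Relation.Nullary.Decidable using (dec-true; dec-false)

  private
    variable
      n : ℕ

  _≟_ : DecidableEquality (Subset n)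
  _≟_ = Vec.≡-dec Bool._≟_

  module _ {n : ℕ} where
    open import Data.List.Membership.DecPropositional (_≟_ {n}) using (_∈?_)

    mem : List (Subset n) → Subset n → Bool
    mem ℱ X = does (X ∈? ℱ)

    ∈⇒mem : ∀ {ℱ X} → X L.∈ ℱ → mem ℱ X ≡ true
    ∈⇒mem {ℱ} {X} = dec-true (X ∈? ℱ)

    ∉⇒mem : ∀ {ℱ X} → ¬ X L.∈ ℱ → mem ℱ X ≡ false
    ∉⇒mem {ℱ} {X} = dec-false (X ∈? ℱ)

    mem⇒∈ : ∀ {ℱ X} → mem ℱ X ≡ true → X L.∈ ℱ
    mem⇒∈ {ℱ} {X} eq with X ∈? ℱ
    mem⇒∈ eq | yes p = p
    mem⇒∈ () | no _

  ∑-point : (W : Subset n → ℤ) (Y : Subset n) → ∑ (λ X → + bit (does (X ≟ Y)) * W X) ≡ W Y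
  ∑-point {zero}  W []          = *-identityˡ (W [])
  ∑-point {suc n} W (false ∷ Y) = trans (cong₂ _+_ (∑-point (lo W) Y) (∑-* 0ℤ (hi W))) (+-identityʳ (W (false ∷ Y)))
  ∑-point {suc n} W (true ∷ Y)  = trans (cong₂ _+_ (∑-* 0ℤ (lo W)) (∑-point (hi W) Y)) (+-identityˡ (W (true ∷ Y)))

  -- The bridge between lists and cube sums: the weights |X|, 1 and the membership bit of i turn it
  -- into norm, length and degree.
  ∑-family : (w : Subset n → ℕ) {ℱ : List (Subset n)} → Unique ℱ →
    ∑ (λ X → ind (mem ℱ) X * + w X) ≡ + sum (map w ℱ)
  ∑-family w {[]}     _            = ∑-* 0ℤ (λ X → + w X)
  ∑-family {n} w {Y ∷ ℱ} (Y≢ ∷ unique) = begin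
    ∑ (λ X → ind (mem (Y ∷ ℱ)) X * + w X)
      ≡⟨ ∑-cong pointwise ⟩
    ∑ ((λ X → + bit (does (X ≟ Y)) * + w X) ⊕ (λ X → ind (mem ℱ) X * + w X))
      ≡⟨ ∑-⊕ (λ X → + bit (does (X ≟ Y)) * + w X) (λ X → ind (mem ℱ) X * + w X) ⟩
    ∑ (λ X → + bit (does (X ≟ Y)) * + w X) + ∑ (λ X → ind (mem ℱ) X * + w X)
      ≡⟨ cong₂ _+_ (∑-point (λ X → + w X) Y) (∑-family w unique) ⟩
    + sum (map w (Y ∷ ℱ)) ∎
    where
    open ≡-Reasoning
    pointwise : ∀ X → ind (mem (Y ∷ ℱ)) X * + w X ≡ + bit (does (X ≟ Y)) * + w X + ind (mem ℱ) X * + w X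
    pointwise X with X ≟ Y
    ... | no _     = sym (+-identityˡ _)
    ... | yes refl rewrite ∉⇒mem {n} {ℱ} {X} (λ X∈ → All.lookup Y≢ X∈ refl) = sym (+-identityʳ _)

  length≡sum : {A : Set} (xs : List A) → length xs ≡ sum (map (λ _ → 1) xs)
  length≡sum []       = refl
  length≡sum (x ∷ xs) = cong suc (length≡sum xs)

  length-filterᵇ : {A : Set} (p : A → Bool) (xs : List A) → length (filterᵇ p xs) ≡ sum (map (λ x → bit (p x)) xs)
  length-filterᵇ p []       = refl
  length-filterᵇ p (x ∷ xs) with p x
  ... | true  = cong suc (length-filterᵇ p xs)
  ... | false = length-filterᵇ p xs

  size-mem : {ℱ : List (Subset n)} → Unique ℱ → size (mem ℱ) ≡ length ℱ
  size-mem {ℱ = ℱ} unique = +-injective (begin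
    + size (mem ℱ)                    ≡⟨ ∑-ind (mem ℱ) ⟨
    ∑ (ind (mem ℱ))                   ≡⟨ ∑-cong (λ X → sym (*-identityʳ (ind (mem ℱ) X))) ⟩
    ∑ (λ X → ind (mem ℱ) X * + 1)     ≡⟨ ∑-family (λ _ → 1) unique ⟩
    + sum (map (λ _ → 1) ℱ)           ≡⟨ cong +_ (length≡sum ℱ) ⟨
    + length ℱ                        ∎)
    where open ≡-Reasoning

  norm-initial : {ℐ : List (Subset n)} → IsColexInitial ℐ → norm ℐ ≡ colexNorm n (length ℐ)
  norm-initial {n} {ℐ} (unique , initial) = begin
    norm ℐ                        ≡⟨ +-injective (trans (sym (∑-family ∣_∣ unique)) (∑-ind-card (mem ℐ))) ⟩
    weight (mem ℐ)                ≡⟨ weight-initial (mem ℐ) (λ X Y Y∈ X<Y → ∈⇒mem (initial X Y (mem⇒∈ Y∈) X<Y)) ⟩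
    colexNorm n (size (mem ℐ))    ≡⟨ cong (colexNorm n) (size-mem unique) ⟩
    colexNorm n (length ℐ)        ∎
    where open ≡-Reasoning

  size-complement : {𝒜 ℬ : List (Subset n)} → Unique ℬ → (∀ X → (X L.∈ ℬ ⇔ (¬ X L.∈ 𝒜))) →
    size (complement (mem 𝒜)) ≡ length ℬ
  size-complement {𝒜 = 𝒜} {ℬ} unique compl = trans (size-cong pointwise) (size-mem unique)
    where
    pointwise : ∀ X → not (mem 𝒜 X) ≡ mem ℬ X
    pointwise X with mem 𝒜 X in eq
    ... | true  = sym (∉⇒mem (λ X∈ℬ → Equivalence.to (compl X) X∈ℬ (mem⇒∈ eq)))
    ... | false = sym (∈⇒mem (Equivalence.from (compl X) (λ X∈𝒜 → false≢true (trans (sym eq) (∈⇒mem X∈𝒜)))))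
      where
      false≢true : ¬ false ≡ true
      false≢true ()

  deg-∑ : {𝒜 : List (Subset n)} → Unique 𝒜 → (i : Fin n) →
    ∑ (λ X → ind (mem 𝒜) X * + bit (memℕ (suc (toℕ i)) X)) ≡ + deg 𝒜 (suc (toℕ i))
  deg-∑ {𝒜 = 𝒜} unique i =
    trans (∑-family (λ X → bit (memℕ (suc (toℕ i)) X)) unique) (cong +_ (sym (length-filterᵇ (memℕ (suc (toℕ i))) 𝒜)))

  0<biasAt : {𝒜 : List (Subset n)} → Unique 𝒜 → Counterexample 𝒜 → ∀ i → 0ℤ < biasAt i (ind (complement (mem 𝒜)))
  0<biasAt {n} {𝒜} unique (_ , _ , rare) i = subst (0ℤ <_) (sym eq) (i<j⇒0<j-i (+<+ (rare (suc (toℕ i)) (ℕ.s≤s ℕ.z≤n))))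
    where
    i<j⇒0<j-i : ∀ {i j} → i < j → 0ℤ < j - i
    i<j⇒0<j-i {i} {j} i<j = subst (_< j - i) (+-inverseʳ i) (+-monoˡ-< (- i) i<j)
    eq : biasAt i (ind (complement (mem 𝒜))) ≡ + length 𝒜 - + (2 ℕ.* deg 𝒜 (suc (toℕ i)))
    eq = trans (biasAt-complement i (mem 𝒜))
      (cong₂ _-_ (cong +_ (size-mem unique)) (trans (cong (_*_ (+ 2)) (deg-∑ unique i)) (sym (pos-* 2 (deg 𝒜 (suc (toℕ i)))))))

  -- If m < 5D, the isoperimetric inequality has slack D. Otherwise the first
  -- Fourier level is negligible and m ≥ (25/51)·2ⁿ.
  large-complement : ∀ {ν m h D E N L} → 0ℤ ≤ N → 0ℤ < D →
    E + D ≤ + 2 * m → ν * m ≤ E + + 2 * h →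
    + 4 * N * m ≤ N * E + + 4 * (m * m) + + 2 * L → L ≤ D * D →
    (0ℤ < m → + 25 * N ≤ + 51 * m → + 5 * ν * m + m < + 10 * h + + 10 * m) →
    + 5 * ν * m + m < + 10 * h + + 10 * m
  large-complement {ν} {m} {h} {D} {E} {N} {L} 0≤N 0<D edges iso fourier L≤D² large with m <? + 5 * D
  ... | yes m<5D = suc[i]≤j⇒i<j (≤-by
      (0≤+ {5} ⊠ gap iso ⊞ 0≤+ {5} ⊠ gap edges ⊞ gap (i<j⇒suc[i]≤j m<5D)) (identity ν m h D E))
    where
    identity : ∀ ν m h D E → + 10 * h + + 10 * m - (+ 1 + (+ 5 * ν * m + m)) ≡
      + 5 * (E + + 2 * h - ν * m) + + 5 * (+ 2 * m - (E + D)) + (+ 5 * D - (+ 1 + m))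
    identity = solve-∀
  -- Eliminating E and L leaves 2Nm ≤ 4m² + 2D². With 25D² ≤ m², supplied by (m - 5D)(m + 5D) ≥ 0,
  -- this becomes 25Nm ≤ 51m², and `m` cancels.
  ... | no m≮5D = large 0<m (*-cancelˡ-≤-pos _ _ m {{positive 0<m}} (*-cancelˡ-≤-pos _ _ (+ 2) (≤-by
      (0≤+ {25} ⊠ gap fourier ⊞ 0≤+ {25} ⊠ (0≤N ⊠ gap edges) ⊞ 0≤+ {25} ⊠ (0≤N ⊠ <⇒≤ 0<D)
        ⊞ 0≤+ {50} ⊠ gap L≤D² ⊞ 0≤+ {2} ⊠ (gap 5D≤m ⊠ (<⇒≤ 0<m ⊞ 0≤5D)))
      (identity m D E N L))))
    where
    5D≤m : + 5 * D ≤ m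
    5D≤m = ≮⇒≥ m≮5D
    0<5D : 0ℤ < + 5 * D
    0<5D = *-monoˡ-<-pos (+ 5) 0<D
    0≤5D : 0ℤ ≤ + 5 * D
    0≤5D = <⇒≤ 0<5D
    0<m : 0ℤ < m
    0<m = <-≤-trans 0<5D 5D≤m
    identity : ∀ m D E N L → + 2 * (m * (+ 51 * m)) - + 2 * (m * (+ 25 * N)) ≡
      + 25 * (N * E + + 4 * (m * m) + + 2 * L - + 4 * N * m) + + 25 * (N * (+ 2 * m - (E + D))) + + 25 * (N * D)
        + + 50 * (D * D - L) + + 2 * ((m - + 5 * D) * (m + + 5 * D))
    identity = solve-∀

  -- From dimension 2 on, `colexNorm-bound` would already suffice for m ≥ (5/12)·2ⁿ; the ratio 25/51
  -- leaves the slack 27m. Dimension 1 lies below the range of that bound, but there the claim only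
  -- asks for 6m < 10h + 10m.
  norm-large : ∀ n m → 0ℤ < + m → + 25 * cubeSize (suc n) ≤ + 51 * + m →
    + 5 * + suc n * + m + + m < + 10 * + colexNorm (suc n) m + + 10 * + m
  norm-large zero m 0<m _ = suc[i]≤j⇒i<j (≤-by
    (0≤+ {10} ⊠ 0≤+ {colexNorm 1 m} ⊞ 0≤+ {3} ⊠ <⇒≤ 0<m ⊞ gap (i<j⇒suc[i]≤j 0<m))
    (identity (+ m) (+ colexNorm 1 m)))
    where
    identity : ∀ m h → + 10 * h + + 10 * m - (+ 1 + (+ 5 * + 1 * m + m)) ≡ + 10 * h + + 3 * m + (m - (+ 1 + + 0))
    identity = solve-∀
  norm-large (suc k) m 0<m 25N≤51m = suc[i]≤j⇒i<j (*-cancelˡ-≤-pos _ _ (+ 20) (≤-by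
    (0≤+ {25} ⊠ gap (colexNorm-bound k m) ⊞ 0≤+ {3} ⊠ gap 25N≤51m ⊞ 0≤+ {27} ⊠ 0≤+ {m} ⊞ 0≤+ {80})
    (identity (+ (2 ℕ.+ k)) (cubeSize (2 ℕ.+ k)) (+ m) (+ colexNorm (2 ℕ.+ k) m))))
    where
    identity : ∀ ν N m h → + 20 * (+ 10 * h + + 10 * m) - + 20 * (+ 1 + (+ 5 * ν * m + m)) ≡
      + 25 * (+ 3 * N + + 8 * h - (+ 4 * ν * m + + 4)) + + 3 * (+ 51 * m - + 25 * N) + + 27 * m + + 80
    identity = solve-∀

  norm-bound : (𝒜 : List (Subset (suc n))) → Unique 𝒜 → Counterexample 𝒜 →
    (ℬ : List (Subset (suc n))) → Unique ℬ → (∀ X → (X L.∈ ℬ ⇔ (¬ X L.∈ 𝒜))) →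
    (ℐ : List (Subset (suc n))) → IsColexInitial ℐ → length ℐ ≡ length ℬ →
    + 5 * + suc n * + length ℬ + + length ℬ < + 10 * + norm ℐ + + 10 * + length ℬ
  norm-bound {n} 𝒜 unique𝒜 counter@(closed , _) ℬ uniqueℬ compl ℐ initial same =
    subst₂ (λ m h → + 5 * + suc n * + m + + m < + 10 * + h + + 10 * + m) size≡ (sym norm≡)
      (large-complement {+ suc n} {+ size f} {+ colexNorm (suc n) (size f)} {bias (ind f)} {energy (ind f)}
        {cubeSize (suc n)} {level₁ (ind f)} (0≤cubeSize (suc n)) (0<bias (ind f) biased)
        (energy+bias≤ (mem 𝒜) (λ X Y X∈ Y∈ → ∈⇒mem (closed X Y (mem⇒∈ X∈) (mem⇒∈ Y∈))))
        (edge-isoperimetry f)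
        (subst₂ (λ x y → + 4 * cubeSize (suc n) * x ≤ cubeSize (suc n) * energy (ind f) + + 4 * (y * y) + + 2 * level₁ (ind f))
          (∑-sq-ind f) (∑-ind f) (poincaré₂ (ind f)))
        (level₁≤bias² (ind f) biased)
        (norm-large n (size f)))
    where
    f : Subset (suc n) → Bool
    f = complement (mem 𝒜)
    biased : ∀ i → 0ℤ < biasAt i (ind f)
    biased = 0<biasAt unique𝒜 counter
    size≡ : size f ≡ length ℬ
    size≡ = size-complement uniqueℬ compl
    norm≡ : norm ℐ ≡ colexNorm (suc n) (size f)
    norm≡ = trans (norm-initial initial) (cong (colexNorm (suc n)) (trans same (sym size≡)))

-- Passage to rationals

module RationalBound where

  open import Data.Integer as ℤ using (+_)
  import Data.Integer.Properties as ℤ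
  open import Data.Integer.Tactic.RingSolver using (solve-∀)
  open import Data.Rational using (1ℚ; _+_; _-_; -_; _*_; _<_; _/_; toℚᵘ)
  open import Data.Rational.Properties
  open import Data.Rational.Unnormalised as ℚᵘ using (mkℚᵘ; _≃_)
  import Data.Rational.Unnormalised.Properties as ℚᵘ
  open import Relation.Binary.PropositionalEquality using (subst₂)

  -- Unnormalised rationals keep the visible denominator 20 = 2 · 10, and their order is
  -- cross-multiplication. Hence the integer inequality is doubled, and -20m moves the term -1 of
  -- n/2 - 1 + 1/10 to the left side.
  fromℤ-bound : ∀ n m h → + 5 ℤ.* + suc n ℤ.* + m ℤ.+ + m ℤ.< + 10 ℤ.* + h ℤ.+ + 10 ℤ.* + m →
    ((+ m) / 1) * ((+ suc n) / 2 - 1ℚ + (+ 1) / 10) < (+ h) / 1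
  fromℤ-bound n m h lt = toℚᵘ-cancel-< (ℚᵘ.<-respˡ-≃ (ℚᵘ.≃-sym lhs≃) (ℚᵘ.<-respʳ-≃ (ℚᵘ.≃-sym (toℚᵘ-fromℚᵘ (mkℚᵘ (+ h) 0)))
      (ℚᵘ.*<* (subst₂ ℤ._<_ (left (+ suc n) (+ m)) (right (+ h) (+ m))
        (ℤ.+-monoˡ-< (ℤ.- (+ 20 ℤ.* + m)) (ℤ.*-monoˡ-<-pos (+ 2) lt))))))
    where
    lhs = mkℚᵘ (+ m) 0 ℚᵘ.* (mkℚᵘ (+ suc n) 1 ℚᵘ.- ℚᵘ.1ℚᵘ ℚᵘ.+ mkℚᵘ (+ 1) 9)
    lhs≃ : toℚᵘ (((+ m) / 1) * ((+ suc n) / 2 - 1ℚ + (+ 1) / 10)) ≃ lhs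
    lhs≃ = ℚᵘ.≃-trans (toℚᵘ-homo-* ((+ m) / 1) ((+ suc n) / 2 - 1ℚ + (+ 1) / 10))
      (ℚᵘ.*-cong (toℚᵘ-fromℚᵘ (mkℚᵘ (+ m) 0))
        (ℚᵘ.≃-trans (toℚᵘ-homo-+ ((+ suc n) / 2 - 1ℚ) ((+ 1) / 10))
          (ℚᵘ.+-congˡ (mkℚᵘ (+ 1) 9)
            (ℚᵘ.≃-trans (toℚᵘ-homo-+ ((+ suc n) / 2) (- 1ℚ)) (ℚᵘ.+-congˡ (ℚᵘ.- ℚᵘ.1ℚᵘ) (toℚᵘ-fromℚᵘ (mkℚᵘ (+ suc n) 1)))))))
    left : ∀ ν m → + 2 ℤ.* (+ 5 ℤ.* ν ℤ.* m ℤ.+ m) ℤ.- + 20 ℤ.* m ≡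
      m ℤ.* ((ν ℤ.* + 1 ℤ.+ ℤ.-[1+ 0 ] ℤ.* + 2) ℤ.* + 10 ℤ.+ + 1 ℤ.* + 2) ℤ.* + 1
    left = solve-∀
    right : ∀ h m → + 2 ℤ.* (+ 10 ℤ.* h ℤ.+ + 10 ℤ.* m) ℤ.- + 20 ℤ.* m ≡ h ℤ.* + 20
    right = solve-∀

open import Data.Integer using (+_; -_)
open import Data.Rational using (ℚ; 0ℚ; 1ℚ; _+_; _-_; _*_; _<_; _/_)
open import Data.Product using (_,_)
open import Data.Rational.Properties using (positive⁻¹)

theorem3 : Σ ℚ λ c₁ → 0ℚ < c₁ ×
    (∀ (n : ℕ) → ∀ (𝒜 : List (Subset (suc n))) → Unique 𝒜 → Counterexample 𝒜 →
    ∀ (ℬ : List (Subset (suc n))) → Unique ℬ → (∀ X → (X L.∈ ℬ ⇔ (¬ X L.∈ 𝒜))) →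
    ∀ (ℐ : List (Subset (suc n))) → IsColexInitial ℐ → length ℐ ≡ length ℬ →
    ((+ length ℬ) / 1) * ((+ suc n) / 2 - 1ℚ + c₁) < (+ norm ℐ) / 1)
theorem3 = (+ 1) / 10 , positive⁻¹ ((+ 1) / 10) , λ n 𝒜 unique𝒜 counter ℬ uniqueℬ compl ℐ initial same →
  RationalBound.fromℤ-bound n (length ℬ) (norm ℐ)
    (Families.norm-bound 𝒜 unique𝒜 counter ℬ uniqueℬ compl ℐ initial same)
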